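{- Given a $k$-bounded space online static bin packing algorithm whose cost on every static instance is at most $c\cdot\mathrm{OPT}^S+\ell$, where $\mathrm{OPT}^S$ is the optimal number of bins for that instance, there exists an online non-clairvoyant algorithm for the dynamic bin packing problem whose average cost (total cost divided by $T$) on every instance is at most $$c\cdot\mu\cdot\mathrm{OPT}_{avg}+\max\{k,\ell\}.$$
   Context: Static bin packing: items of sizes in $(0,1]$ are packed into unit-capacity bins and never depart; the cost is the number of bins used. An online static bin packing algorithm packs items one at a time irrevocably; it is $k$-bounded space if, for each new item, the number of bins in which it can be packed (the active bins) is at most $k$. Dynamic bin packing. Time is discretized into steps $t=1,\dots,T$. An instance is a finite set of intervals $I=[s_I,e_I)$ with integer endpoints and size $w_I\in(0,1]$; $I$ is active at $t$ if $s_I\le t<e_I$. Lengths $e_I-s_I$ are normalized so that the minimum is $1$; $\mu$ is the maximum length. At each time step at least one interval is active. Each interval is assigned to one machine for its entire duration (no migration); at each time the total size of active intervals on a machine is at most $1$. A machine is active at $t$ if some interval assigned to it is active at $t$. The total cost is the total active time summed over all machines; $\mathrm{OPT}$ is the minimum (offline) cost and $\mathrm{OPT}_{avg}=\mathrm{OPT}/T$. An online algorithm must assign each interval irrevocably upon arrival; it is non-clairvoyant if, upon arrival of an interval, it learns its size but nothing about its length/departure time. -}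

module Defs where

open import Level using (Level; _⊔_; suc)
open import Algebra.Bundles using (CommutativeRing)
open import Algebra.Structures using (IsCommutativeRing)
open import Relation.Binary.Core using (Rel)
open import Relation.Binary.Bundles using (DecTotalOrder)
open import Relation.Binary.Structures using (IsDecTotalOrder)
open import Relation.Binary.PropositionalEquality using (_≡_; _≢_)

-- Item sizes, c and ℓ are real numbers in the mathematics.  They are taken here
-- from an arbitrary ordered field; classically, ℝ is one.  The inverse is total,
-- with an unconstrained value at 0#.
record OrderedField (a r : Level) : Set (suc (a ⊔ r)) where
  infix  8 _⁻¹
  infix  8 -_
  infixl 7 _*_
  infixl 6 _+_
  infix  4 _≤_
  field
    Carrier           : Set a
    _≤_               : Rel Carrier r
    _+_ _*_           : Carrier → Carrier → Carrier
    -_ _⁻¹            : Carrier → Carrier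
    0# 1#             : Carrier
    isCommutativeRing : IsCommutativeRing _≡_ _+_ _*_ -_ 0# 1#
    isDecTotalOrder   : IsDecTotalOrder _≡_ _≤_
    0≢1               : 0# ≢ 1#
    ⁻¹-inverseʳ       : ∀ x → x ≢ 0# → x * x ⁻¹ ≡ 1#
    +-monoʳ-≤         : ∀ z {x y} → x ≤ y → z + x ≤ z + y
    *-nonNegative     : ∀ {x y} → 0# ≤ x → 0# ≤ y → 0# ≤ x * y

  commutativeRing : CommutativeRing a a
  commutativeRing = record { isCommutativeRing = isCommutativeRing }

  decTotalOrder : DecTotalOrder a a r
  decTotalOrder = record { isDecTotalOrder = isDecTotalOrder }

  open import Relation.Binary.Construct.NonStrictToStrict _≡_ _≤_ public
    using (_<_)

  open import Algebra.Construct.NaturalChoice.Max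
    (DecTotalOrder.totalOrder decTotalOrder) public
    using () renaming (_⊔_ to max)

  open import Algebra.Properties.Semiring.Mult
    (CommutativeRing.semiring commutativeRing) using (_×_)

  open import Algebra.Properties.CommutativeMonoid.Sum
    (CommutativeRing.+-commutativeMonoid commutativeRing) public
    using (sum)

  open import Data.Nat.Base using (ℕ)

  infixl 7 _/_
  _/_ : Carrier → Carrier → Carrier
  x / y = x * y ⁻¹

  fromℕ : ℕ → Carrier
  fromℕ n = n × 1#

module BinPacking {a r : Level} (F : OrderedField a r) where

  open OrderedField F
  open import Data.Bool.Base using (if_then_else_)
  open import Data.Fin.Base as Fin using (Fin; toℕ)
  open import Data.List.Base as List
    using (List; []; _∷_; _∷ʳ_; take; length; deduplicate; filter; allFin; applyUpTo)
  open import Data.List.Extrema.Nat as Extrema using ()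
  open import Data.List.Membership.Propositional using (_∈_)
  open import Data.Maybe.Base using (Maybe; just; nothing)
  open import Data.Nat.Base as ℕ using (ℕ)
  open import Data.Nat.ListAction as ℕ using ()
  open import Data.Nat.Properties as ℕ using ()
  open import Data.Product.Base using (_×_; ∃; ∃-syntax)
  open import Data.Sum.Base using (_⊎_)
  open import Data.Vec.Functional using (Vector; toList)
  open import Function.Base using (_∘_)
  open import Relation.Nullary.Decidable using (Dec; does; _×-dec_)

  distinct : List ℕ → ℕ
  distinct = length ∘ deduplicate ℕ._≟_

  IsMinimum : ∀ {p q} {X : Set p} (P : X → Set q) (f : X → ℕ) → ℕ → Set (p ⊔ q)
  IsMinimum P f m = (∃[ x ] P x × f x ≡ m) × (∀ x → P x → m ℕ.≤ f x)

  before : ∀ {p} {X : Set p} {n} → Vector X n → Fin n → List X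
  before xs i = take (toℕ i) (toList xs)

  ValidSize : Carrier → Set (a ⊔ r)
  ValidSize w = 0# < w × w ≤ 1#

  -- An instance is the sequence of item sizes in order of arrival; bins (and,
  -- below, machines) are labelled by natural numbers.
  ValidSizes : ∀ {n} → Vector Carrier n → Set (a ⊔ r)
  ValidSizes σ = ∀ i → ValidSize (σ i)

  binLoad : ∀ {n} → Vector Carrier n → (Fin n → ℕ) → ℕ → Carrier
  binLoad σ p b = sum (λ i → if does (p i ℕ.≟ b) then σ i else 0#)

  IsPacking : ∀ {n} → Vector Carrier n → (Fin n → ℕ) → Set r
  IsPacking σ p = ∀ b → binLoad σ p b ≤ 1#

  binsUsed : ∀ {n} → (Fin n → ℕ) → ℕ
  binsUsed p = distinct (toList p)

  IsOPTˢ : ∀ {n} → Vector Carrier n → ℕ → Set r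
  IsOPTˢ σ = IsMinimum (IsPacking σ) binsUsed

  -- A deterministic online algorithm is a function of the items seen so far and
  -- the current item; its own earlier decisions are determined by the former.
  runˢ : (List Carrier → Carrier → ℕ) → ∀ {n} → Vector Carrier n → Fin n → ℕ
  runˢ pack σ i = pack (before σ i) (σ i)

  record StaticAlgorithm : Set (a ⊔ r) where
    field
      pack     : List Carrier → Carrier → ℕ
      feasible : ∀ {n} (σ : Vector Carrier n) → ValidSizes σ →
                 IsPacking σ (runˢ pack σ)

  open StaticAlgorithm public

  -- After each history there are at most k active bins.  The next item goes to
  -- an active bin or opens a new one, and a bin that is no longer active never
  -- becomes active again.
  record BoundedSpace (k : ℕ) (A : StaticAlgorithm) : Set (a ⊔ r) where
    field
      active   : List Carrier → List ℕ
      active-≤ : ∀ {n} (σ : Vector Carrier n) → ValidSizes σ →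
                 length (active (toList σ)) ℕ.≤ k
      placed   : ∀ {n} (σ : Vector Carrier n) → ValidSizes σ →
                 ∀ w → ValidSize w →
                 pack A (toList σ) w ∈ active (toList σ)
                 ⊎ (∀ i → runˢ (pack A) σ i ≢ pack A (toList σ) w)
      closed   : ∀ {n} (σ : Vector Carrier n) → ValidSizes σ →
                 ∀ w → ValidSize w → ∀ b →
                 b ∈ active (toList σ ∷ʳ w) →
                 b ∈ active (toList σ) ⊎ b ≡ pack A (toList σ) w

  StaticCostBound : StaticAlgorithm → (c ℓ : Carrier) → Set (a ⊔ r)
  StaticCostBound A c ℓ =
    ∀ {n} (σ : Vector Carrier n) → ValidSizes σ → ∀ opt → IsOPTˢ σ opt →
    fromℕ (binsUsed (runˢ (pack A) σ)) ≤ c * fromℕ opt + ℓ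

  record Interval : Set a where
    field
      start end : ℕ
      size      : Carrier

    duration : ℕ
    duration = end ℕ.∸ start

  open Interval public

  ActiveAt : ℕ → Interval → Set
  ActiveAt t I = start I ℕ.≤ t × t ℕ.< end I

  activeAt? : ∀ t I → Dec (ActiveAt t I)
  activeAt? t I = (start I ℕ.≤? t) ×-dec (t ℕ.<? end I)

  -- The intervals are listed in order of arrival; simultaneous arrivals may be
  -- listed in any order.  Time steps are 1, …, T.
  record Instance : Set (a ⊔ r) where
    field
      n T       : ℕ
      intervals : Vector Interval n
      ordered   : ∀ i j → i Fin.≤ j → start (intervals i) ℕ.≤ start (intervals j)
      nonEmpty  : ∀ i → start (intervals i) ℕ.< end (intervals i)
      horizon   : ∀ i → 1 ℕ.≤ start (intervals i) × end (intervals i) ℕ.≤ ℕ.suc T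
      validSize : ∀ i → ValidSize (size (intervals i))
      shortest  : ∃[ i ] duration (intervals i) ≡ 1
      busy      : ∀ t → 1 ℕ.≤ t → t ℕ.≤ T → ∃[ i ] ActiveAt t (intervals i)

    μ : ℕ
    μ = Extrema.max 0 (toList (duration ∘ intervals))

  open Instance public

  machineLoad : (J : Instance) → (Fin (n J) → ℕ) → ℕ → ℕ → Carrier
  machineLoad J p t m = sum λ i →
    if does (activeAt? t (intervals J i) ×-dec (p i ℕ.≟ m))
    then size (intervals J i) else 0#

  IsSchedule : (J : Instance) → (Fin (n J) → ℕ) → Set r
  IsSchedule J p = ∀ t m → machineLoad J p t m ≤ 1#

  activeMachines : (J : Instance) → (Fin (n J) → ℕ) → ℕ → ℕ
  activeMachines J p t =
    distinct (List.map p (filter (λ i → activeAt? t (intervals J i)) (allFin (n J))))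

  totalCost : (J : Instance) → (Fin (n J) → ℕ) → ℕ
  totalCost J p = ℕ.sum (applyUpTo (λ s → activeMachines J p (ℕ.suc s)) (T J))

  IsOPT : Instance → ℕ → Set r
  IsOPT J = IsMinimum (IsSchedule J) (totalCost J)

  average : Instance → ℕ → Carrier
  average J x = fromℕ x / fromℕ (T J)

  -- What is known at time t about an interval that has arrived: its departure
  -- is visible only once it has taken place.
  record Observation : Set a where
    field
      arrival   : ℕ
      weight    : Carrier
      departure : Maybe ℕ

  observe : ℕ → Interval → Observation
  observe t I = record
    { arrival   = start I
    ; weight    = size I
    ; departure = if does (end I ℕ.≤? t) then just (end I) else nothing
    }

  -- The arguments of the assignment rule are the earlier arrivals as observed
  -- now, the current time, and the size of the arriving interval.
  run : (List Observation → ℕ → Carrier → ℕ) → (J : Instance) → Fin (n J) → ℕ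
  run assign J i = assign (List.map (observe now) (before (intervals J) i)) now (size I)
    where
    I   = intervals J i
    now = start I

  record NonClairvoyantAlgorithm : Set (a ⊔ r) where
    field
      assign   : List Observation → ℕ → Carrier → ℕ
      feasible : ∀ J → IsSchedule J (run assign J)

  open NonClairvoyantAlgorithm public using (assign)

{-# OPTIONS --safe #-}
module Submission where

-- Pack every arriving item by the static algorithm as if nothing ever departed, one machine per bin.
-- An interval active at t arrived after t ∸ μ, so a machine active at t was either opened after
-- t ∸ μ, or its bin was in use by then and is used again, hence was among the at most k active bins;
-- the latter needs t > μ.  If N bins are used, summing over t gives a total cost of at most
-- μ N + k (T ∸ μ).  An optimal schedule of cost OPT yields a static packing into at most OPT bins, one for
-- each pair (arrival time, machine), so N ≤ c OPT + ℓ, and μ ℓ + k (T ∸ μ) ≤ T max{k, ℓ}.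
-- A static optimum exists only up to double negation, which suffices because ≤ is decidable.

open import Defs
open import Level using (Level)
open import Data.Bool.Base using (true; false; if_then_else_)
open import Data.Empty using (⊥)
open import Data.Fin.Base as Fin using (Fin; toℕ; fromℕ<; inject≤)
open import Data.Fin.Properties as Fin using ()
open import Data.List.Base as List
  using (List; []; _∷_; _++_; _∷ʳ_; allFin; applyUpTo; concatMap; deduplicate;
         filter; length; lookup; map; tabulate; take)
open import Data.List.Extrema.Nat as Extrema using ()
open import Data.List.Membership.Propositional using (_∈_)
open import Data.List.Membership.Propositional.Properties
open import Data.List.Properties
open import Data.List.Relation.Binary.Subset.Propositional using (_⊆_)
open import Data.List.Relation.Unary.All as All using ([]; _∷_)
open import Data.List.Relation.Unary.All.Properties as All using ()
open import Data.List.Relation.Unary.AllPairs using ([]; _∷_)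
open import Data.List.Relation.Unary.Any as Any using (here; there)
open import Data.List.Relation.Unary.Any.Properties as Any using ()
open import Data.List.Relation.Unary.Unique.Propositional using (Unique)
open import Data.List.Relation.Unary.Unique.Propositional.Properties as Unique using ()
open import Data.Nat.Base as ℕ using (ℕ; zero; suc; z≤n; s≤s; _∸_)
open import Data.Nat.DivMod using ([m+kn]%n≡m%n; m<n⇒m%n≡m)
open import Data.Nat.Induction using (<-rec)
open import Data.Nat.ListAction as ℕ using ()
open import Data.Nat.Properties as ℕ using ()
open import Data.Product.Base using (_×_; _,_; proj₁; proj₂; ∃; ∃-syntax)
open import Data.Sum.Base using (_⊎_; inj₁; inj₂)
open import Data.Vec.Functional using (Vector; toList)
open import Function.Base using (_∘_; id)
open import Relation.Binary.PropositionalEquality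
open import Relation.Binary.Bundles using (DecTotalOrder)
import Relation.Binary.Reasoning.PartialOrder as PosetReasoning
import Algebra.Construct.NaturalChoice.Max as MaxProperties
open import Relation.Nullary using (¬_; Dec; yes; no; does; contradiction)
open import Relation.Nullary.Decidable using (dec-true; decidable-stable; _×-dec_)
open import Relation.Unary using (Pred; Decidable)
import Data.List.Relation.Unary.Unique.DecPropositional.Properties as DecUnique

private
  variable
    a b p q : Level
    X : Set a
    Y : Set b

-- Counting in finite lists.

module _ {X : Set a} where

  lookup-injective : ∀ {xs : List X} → Unique xs → ∀ {i j} → lookup xs i ≡ lookup xs j → i ≡ j
  lookup-injective (_  ∷ _) {Fin.zero}  {Fin.zero}  _  = refl
  lookup-injective (x∉ ∷ _) {Fin.zero}  {Fin.suc j} eq = contradiction eq (All.lookup x∉ (∈-lookup j))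
  lookup-injective (x∉ ∷ _) {Fin.suc i} {Fin.zero}  eq =
    contradiction (sym eq) (All.lookup x∉ (∈-lookup i))
  lookup-injective (_  ∷ u) {Fin.suc i} {Fin.suc j} eq = cong Fin.suc (lookup-injective u eq)

  -- Pigeonhole: sending each entry of `xs` to its position in `ys` is injective, because the
  -- position determines the entry and `xs` has no repetitions.
  unique-⊆⇒length-≤ : ∀ {xs ys : List X} → Unique xs → xs ⊆ ys → length xs ℕ.≤ length ys
  unique-⊆⇒length-≤ {xs} {ys} u xs⊆ys = Fin.injective⇒≤ {f = position} λ {i} {j} eq →
    lookup-injective u (begin
      lookup xs i             ≡⟨ Any.lookup-index (xs⊆ys (∈-lookup i)) ⟩
      lookup ys (position i)  ≡⟨ cong (lookup ys) eq ⟩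
      lookup ys (position j)  ≡⟨ Any.lookup-index (xs⊆ys (∈-lookup j)) ⟨
      lookup xs j             ∎)
    where
    open ≡-Reasoning
    position : Fin (length xs) → Fin (length ys)
    position i = Any.index (xs⊆ys (∈-lookup i))

  sum-map-mono : ∀ {f g : X → ℕ} xs → (∀ {x} → x ∈ xs → f x ℕ.≤ g x) →
                 ℕ.sum (map f xs) ℕ.≤ ℕ.sum (map g xs)
  sum-map-mono []       f≤g = z≤n
  sum-map-mono (x ∷ xs) f≤g = ℕ.+-mono-≤ (f≤g (here refl)) (sum-map-mono xs (f≤g ∘ there))

  sum-map-≤ : ∀ {f : X → ℕ} {m} xs → (∀ x → f x ℕ.≤ m) → ℕ.sum (map f xs) ℕ.≤ length xs ℕ.* m
  sum-map-≤ []       f≤m = z≤n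
  sum-map-≤ (x ∷ xs) f≤m = ℕ.+-mono-≤ (f≤m x) (sum-map-≤ xs f≤m)

  sum-map-+ : ∀ (f g : X → ℕ) xs →
              ℕ.sum (map (λ x → f x ℕ.+ g x) xs) ≡ ℕ.sum (map f xs) ℕ.+ ℕ.sum (map g xs)
  sum-map-+ f g []       = refl
  sum-map-+ f g (x ∷ xs) rewrite sum-map-+ f g xs =
    +-interchange (f x) (g x) (ℕ.sum (map f xs)) (ℕ.sum (map g xs))
    where open import Algebra.Properties.CommutativeSemigroup ℕ.+-commutativeSemigroup
            using () renaming (interchange to +-interchange)

  sum-map-if : ∀ {P : Pred X p} (P? : Decidable P) k xs →
               ℕ.sum (map (λ x → if does (P? x) then k else 0) xs) ≡ length (filter P? xs) ℕ.* k
  sum-map-if P? k []       = refl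
  sum-map-if P? k (x ∷ xs) with does (P? x)
  ... | true  = cong (k ℕ.+_) (sum-map-if P? k xs)
  ... | false = sum-map-if P? k xs

  length-concatMap : ∀ (f : X → List Y) xs →
                     length (concatMap f xs) ≡ ℕ.sum (map (length ∘ f) xs)
  length-concatMap f []       = refl
  length-concatMap f (x ∷ xs) =
    trans (length-++ (f x)) (cong (length (f x) ℕ.+_) (length-concatMap f xs))

  length-filter-∷ : ∀ {P : Pred X p} (P? : Decidable P) x xs →
                    length (filter P? (x ∷ xs)) ≡ (if does (P? x) then 1 else 0) ℕ.+ length (filter P? xs)
  length-filter-∷ P? x xs with does (P? x)
  ... | true  = refl
  ... | false = refl

-- Both sides count the related pairs. In the cost estimate this exchanges time steps and machines.
double-counting : ∀ {R : X → Y → Set p} (R? : ∀ x y → Dec (R x y)) xs ys →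
                  ℕ.sum (map (λ x → length (filter (R? x) ys)) xs) ≡
                  ℕ.sum (map (λ y → length (filter (λ x → R? x y) xs)) ys)
double-counting R? [] ys = sym (ℕ.n≤0⇒n≡0 (begin
  ℕ.sum (map (λ _ → 0) ys)  ≤⟨ sum-map-≤ ys (λ _ → z≤n) ⟩
  length ys ℕ.* 0           ≡⟨ ℕ.*-zeroʳ (length ys) ⟩
  0                         ∎))
  where open ℕ.≤-Reasoning
double-counting R? (x ∷ xs) ys = sym (begin
  ℕ.sum (map (λ y → length (filter (λ x → R? x y) (x ∷ xs))) ys)
    ≡⟨ cong ℕ.sum (map-cong (λ y → length-filter-∷ (λ x → R? x y) x xs) ys) ⟩
  ℕ.sum (map (λ y → (if does (R? x y) then 1 else 0) ℕ.+ length (filter (λ x → R? x y) xs)) ys)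
    ≡⟨ sum-map-+ _ _ ys ⟩
  ℕ.sum (map (λ y → if does (R? x y) then 1 else 0) ys)
    ℕ.+ ℕ.sum (map (λ y → length (filter (λ x → R? x y) xs)) ys)
    ≡⟨ cong₂ ℕ._+_ (trans (sum-map-if (R? x) 1 ys) (ℕ.*-identityʳ _)) (sym (double-counting R? xs ys)) ⟩
  length (filter (R? x) ys) ℕ.+ ℕ.sum (map (λ x → length (filter (R? x) ys)) xs) ∎)
  where open ≡-Reasoning

-- Supplies a cut in the order of arrival: having arrived by a given time is downward closed, so it
-- singles out the first `m` items, and one can ask which bins are active after them.
initial-segment : ∀ {n} {P : Pred (Fin n) p} (P? : Decidable P) →
                  (∀ {i j} → i Fin.≤ j → P j → P i) →
                  ∃[ m ] m ℕ.≤ n × (∀ {i} → P i → toℕ i ℕ.< m) × (∀ {i} → toℕ i ℕ.< m → P i)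
initial-segment {n = zero}  P? down = 0 , z≤n , (λ { {()} }) , λ ()
initial-segment {n = suc n} P? down with P? Fin.zero
... | no ¬p₀ = 0 , z≤n , (λ pᵢ → contradiction (down z≤n pᵢ) ¬p₀) , λ ()
... | yes p₀ with initial-segment (P? ∘ Fin.suc) (down ∘ s≤s)
...   | m , m≤n , bound , inside =
  suc m , s≤s m≤n ,
  (λ { {Fin.zero} _ → s≤s z≤n ; {Fin.suc i} pᵢ → s≤s (bound pᵢ) }) ,
  (λ { {Fin.zero} _ → p₀ ; {Fin.suc i} (s≤s i<m) → inside i<m })

take-tabulate : ∀ {m n} (m≤n : m ℕ.≤ n) (f : Fin n → X) →
                take m (tabulate f) ≡ tabulate (λ i → f (inject≤ i m≤n))
take-tabulate z≤n       f = refl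
take-tabulate (s≤s m≤n) f = cong (f Fin.zero ∷_) (take-tabulate m≤n (f ∘ Fin.suc))

distinct-≤ : ∀ {xs ys : List ℕ} → xs ⊆ ys → length (deduplicate ℕ._≟_ xs) ℕ.≤ length ys
distinct-≤ {xs} xs⊆ys =
  unique-⊆⇒length-≤ (DecUnique.deduplicate-! ℕ._≟_ xs) (xs⊆ys ∘ ∈-deduplicate⁻ ℕ._≟_ xs)

-- The selected steps are distinct and all lie among `m` consecutive numbers starting at `o`.
length-filter-steps : ∀ {P : Pred ℕ p} (P? : Decidable P) T o m →
                      (∀ {t} → P t → 1 ℕ.≤ t → t ℕ.≤ T → o ℕ.≤ t × t ℕ.< o ℕ.+ m) →
                      length (filter P? (applyUpTo suc T)) ℕ.≤ m
length-filter-steps P? T o m window = begin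
  length (filter P? (applyUpTo suc T))  ≤⟨ unique-⊆⇒length-≤ unique sub ⟩
  length (applyUpTo (o ℕ.+_) m)     ≡⟨ length-applyUpTo (o ℕ.+_) m ⟩
  m                                     ∎
  where
  open ℕ.≤-Reasoning
  unique : Unique (filter P? (applyUpTo suc T))
  unique = Unique.filter⁺ P? (Unique.applyUpTo⁺₁ suc T λ i<j _ eq → ℕ.<⇒≢ i<j (ℕ.suc-injective eq))
  sub : filter P? (applyUpTo suc T) ⊆ applyUpTo (o ℕ.+_) m
  sub t∈ with ∈-filter⁻ P? {xs = applyUpTo suc T} t∈
  ... | t∈steps , pt with ∈-applyUpTo⁻ suc t∈steps
  ...   | s , s<T , refl with window pt (s≤s z≤n) s<T
  ...     | o≤t , t<end = subst (_∈ applyUpTo (o ℕ.+_) m) (ℕ.m+[n∸m]≡n o≤t)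
    (∈-applyUpTo⁺ (o ℕ.+_) (ℕ.+-cancelˡ-< o _ _
      (subst (ℕ._< o ℕ.+ m) (sym (ℕ.m+[n∸m]≡n o≤t)) t<end)))

-- If no least value existed, strong induction on `v` would show that no element of `P` has value
-- `v`, against `px`.
¬¬-minimum : ∀ {P : X → Set p} (f : X → ℕ) {x} → P x →
             ¬ ¬ (∃[ m ] (∃[ y ] P y × f y ≡ m) × (∀ y → P y → m ℕ.≤ f y))
¬¬-minimum {X = X} {P = P} f px none = <-rec (λ v → ∀ x → P x → f x ≡ v → ⊥) step _ _ px refl
  where
  step : ∀ v → (∀ {u} → u ℕ.< v → ∀ x → P x → f x ≡ u → ⊥) → ∀ x → P x → f x ≡ v → ⊥
  step _ smaller x px refl =
    none (f x , (x , px , refl) , λ y py → ℕ.≮⇒≥ λ fy<fx → smaller fy<fx y py refl)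

-- Arithmetic in ordered fields.

module OrderedFieldProperties {a r} (F : OrderedField a r) where

  open OrderedField F
  open import Algebra.Bundles using (CommutativeRing)
  module R = CommutativeRing commutativeRing
  module O = DecTotalOrder decTotalOrder
  open import Algebra.Properties.Ring R.ring using (-1*x≈-x)
  open import Algebra.Properties.Group R.+-group using () renaming (⁻¹-involutive to -‿involutive)
  open import Algebra.Properties.Semiring.Mult R.semiring using (×-homo-+; ×1-homo-*)
  open import Algebra.Properties.CommutativeMonoid.Sum R.+-commutativeMonoid public
    using (sum-replicate-zero)
  module ≤-Reasoning = PosetReasoning O.poset

  +-mono-≤ : ∀ {x y u v} → x ≤ y → u ≤ v → x + u ≤ y + v
  +-mono-≤ {x} {y} {u} {v} x≤y u≤v = O.trans (+-monoʳ-≤ x u≤v)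
    (subst₂ _≤_ (R.+-comm v x) (R.+-comm v y) (+-monoʳ-≤ v x≤y))

  neg-nonNegative : ∀ {x} → x ≤ 0# → 0# ≤ - x
  neg-nonNegative {x} x≤0 = subst₂ _≤_ (R.-‿inverseˡ x) (R.+-identityʳ (- x)) (+-monoʳ-≤ (- x) x≤0)

  *-monoˡ-≤ : ∀ {z x y} → 0# ≤ z → x ≤ y → z * x ≤ z * y
  *-monoˡ-≤ {z} {x} {y} 0≤z x≤y = subst₂ _≤_ (R.+-identityʳ (z * x)) cancel
    (+-monoʳ-≤ (z * x) (*-nonNegative 0≤z 0≤y-x))
    where
    open ≡-Reasoning
    0≤y-x : 0# ≤ - x + y
    0≤y-x = subst (_≤ - x + y) (R.-‿inverseˡ x) (+-monoʳ-≤ (- x) x≤y)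
    cancel : z * x + z * (- x + y) ≡ z * y
    cancel = begin
      z * x + z * (- x + y)  ≡⟨ R.distribˡ z x (- x + y) ⟨
      z * (x + (- x + y))    ≡⟨ cong (z *_) (R.+-assoc x (- x) y) ⟨
      z * ((x + - x) + y)    ≡⟨ cong (λ h → z * (h + y)) (R.-‿inverseʳ x) ⟩
      z * (0# + y)           ≡⟨ cong (z *_) (R.+-identityˡ y) ⟩
      z * y                  ∎

  *-monoʳ-≤ : ∀ {z x y} → 0# ≤ z → x ≤ y → x * z ≤ y * z
  *-monoʳ-≤ {z} {x} {y} 0≤z x≤y = subst₂ _≤_ (R.*-comm z x) (R.*-comm z y) (*-monoˡ-≤ 0≤z x≤y)

  nonPositive*nonNegative : ∀ {x y} → x ≤ 0# → 0# ≤ y → x * y ≤ 0#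
  nonPositive*nonNegative {x} {y} x≤0 0≤y = subst (x * y ≤_) (R.zeroˡ y) (*-monoʳ-≤ 0≤y x≤0)

  0≤1 : 0# ≤ 1#
  0≤1 with O.total 0# 1#
  ... | inj₁ 0≤1 = 0≤1
  -- If `1# ≤ 0#`, then `- 1#` is nonnegative, and so is its square, which is `1#`.
  ... | inj₂ 1≤0 = subst (0# ≤_) -1*-1≡1 (*-nonNegative 0≤-1 0≤-1)
    where
    0≤-1 = neg-nonNegative 1≤0
    -1*-1≡1 : - 1# * - 1# ≡ 1#
    -1*-1≡1 = trans (-1*x≈-x (- 1#)) (-‿involutive 1#)

  1≰0 : ¬ 1# ≤ 0#
  1≰0 1≤0 = 0≢1 (O.antisym 0≤1 1≤0)

  fromℕ-nonNegative : ∀ n → 0# ≤ fromℕ n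
  fromℕ-nonNegative zero    = O.refl
  fromℕ-nonNegative (suc n) = subst (_≤ fromℕ (suc n)) (R.+-identityʳ 0#) (+-mono-≤ 0≤1 (fromℕ-nonNegative n))

  fromℕ-+ : ∀ m n → fromℕ (m ℕ.+ n) ≡ fromℕ m + fromℕ n
  fromℕ-+ = ×-homo-+ 1#

  fromℕ-* : ∀ m n → fromℕ (m ℕ.* n) ≡ fromℕ m * fromℕ n
  fromℕ-* = ×1-homo-*

  fromℕ-mono-≤ : ∀ {m n} → m ℕ.≤ n → fromℕ m ≤ fromℕ n
  fromℕ-mono-≤ {n = n} z≤n = fromℕ-nonNegative n
  fromℕ-mono-≤ (s≤s m≤n)   = +-monoʳ-≤ 1# (fromℕ-mono-≤ m≤n)

  fromℕ-suc≢0 : ∀ n → fromℕ (suc n) ≢ 0#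
  fromℕ-suc≢0 n eq = 1≰0 (subst₂ _≤_ (R.+-identityʳ 1#) eq (fromℕ-mono-≤ {1} {suc n} (s≤s z≤n)))

  -- Otherwise `1#`, the product of `x ⁻¹` and `x`, would be at most `0#`.
  ⁻¹-nonNegative : ∀ {x} → 0# ≤ x → x ≢ 0# → 0# ≤ x ⁻¹
  ⁻¹-nonNegative {x} 0≤x x≢0 with O.total 0# (x ⁻¹)
  ... | inj₁ 0≤x⁻¹ = 0≤x⁻¹
  ... | inj₂ x⁻¹≤0 = contradiction
    (subst (_≤ 0#) (trans (R.*-comm (x ⁻¹) x) (⁻¹-inverseʳ x x≢0)) (nonPositive*nonNegative x⁻¹≤0 0≤x)) 1≰0

  sum-mono-≤ : ∀ {n} {f g : Vector Carrier n} → (∀ i → f i ≤ g i) → sum f ≤ sum g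
  sum-mono-≤ {zero}  f≤g = O.refl
  sum-mono-≤ {suc n} f≤g = +-mono-≤ (f≤g Fin.zero) (sum-mono-≤ (f≤g ∘ Fin.suc))

  x≤x+y : ∀ {x y} → 0# ≤ y → x ≤ x + y
  x≤x+y {x} {y} 0≤y = subst (_≤ x + y) (R.+-identityʳ x) (+-monoʳ-≤ x 0≤y)

  x≤y+x : ∀ {x y} → 0# ≤ y → x ≤ y + x
  x≤y+x {x} {y} 0≤y = subst (x ≤_) (R.+-comm x y) (x≤x+y 0≤y)

  sum-nonNegative : ∀ {n} {f : Vector Carrier n} → (∀ i → 0# ≤ f i) → 0# ≤ sum f
  sum-nonNegative {zero}  0≤f = O.refl
  sum-nonNegative {suc n} 0≤f = O.trans (0≤f Fin.zero) (x≤x+y (sum-nonNegative (0≤f ∘ Fin.suc)))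

  term-≤-sum : ∀ {n} {f : Vector Carrier n} → (∀ i → 0# ≤ f i) → ∀ i → f i ≤ sum f
  term-≤-sum 0≤f Fin.zero    = x≤x+y (sum-nonNegative (0≤f ∘ Fin.suc))
  term-≤-sum 0≤f (Fin.suc i) = O.trans (term-≤-sum (0≤f ∘ Fin.suc) i) (x≤y+x (0≤f Fin.zero))

  two-terms-≤-sum : ∀ {n} {f : Vector Carrier n} → (∀ i → 0# ≤ f i) →
                    ∀ {i j} → i ≢ j → f i + f j ≤ sum f
  two-terms-≤-sum 0≤f {Fin.zero}  {Fin.zero}  i≢j = contradiction refl i≢j
  two-terms-≤-sum 0≤f {Fin.zero}  {Fin.suc j} i≢j = +-monoʳ-≤ _ (term-≤-sum (0≤f ∘ Fin.suc) j)
  two-terms-≤-sum {f = f} 0≤f {Fin.suc i} {Fin.zero} i≢j =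
    subst (_≤ sum f) (R.+-comm _ _) (+-monoʳ-≤ _ (term-≤-sum (0≤f ∘ Fin.suc) i))
  two-terms-≤-sum 0≤f {Fin.suc i} {Fin.suc j} i≢j =
    O.trans (two-terms-≤-sum (0≤f ∘ Fin.suc) (i≢j ∘ cong Fin.suc)) (x≤y+x (0≤f Fin.zero))

  -- Comparisons of loads go through this term by term: it suffices that every item counted in the
  -- smaller load is counted in the larger one.
  if-mono-≤ : ∀ {P : Set p} {Q : Set q} (P? : Dec P) (Q? : Dec Q) {w} → 0# ≤ w → (P → Q) →
              (if does P? then w else 0#) ≤ (if does Q? then w else 0#)
  if-mono-≤ (yes _) (yes _) 0≤w P⇒Q = O.refl
  if-mono-≤ (yes p) (no ¬q) 0≤w P⇒Q = contradiction (P⇒Q p) ¬q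
  if-mono-≤ (no _)  (yes _) 0≤w P⇒Q = 0≤w
  if-mono-≤ (no _)  (no _)  0≤w P⇒Q = O.refl

  if-nonNegative : ∀ b {w} → 0# ≤ w → 0# ≤ (if b then w else 0#)
  if-nonNegative true  0≤w = 0≤w
  if-nonNegative false 0≤w = O.refl

module BinPackingProperties {a r} (F : OrderedField a r) where

  open OrderedField F
  open OrderedFieldProperties F
  open BinPacking F

  -- Static packings and the static cost bound.

  binsUsed-≤ : ∀ {n} (p : Fin n → ℕ) {ys} → (∀ i → p i ∈ ys) → binsUsed p ℕ.≤ length ys
  binsUsed-≤ p p∈ys = distinct-≤ λ x∈ → let i , eq = ∈-tabulate⁻ x∈ in subst (_∈ _) (sym eq) (p∈ys i)

  injective⇒binsUsed-≥ : ∀ {n} (p : Fin n → ℕ) → (∀ {i j} → p i ≡ p j → i ≡ j) → n ℕ.≤ binsUsed p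
  injective⇒binsUsed-≥ p injective = subst (ℕ._≤ binsUsed p) (length-tabulate p)
    (unique-⊆⇒length-≤ (Unique.tabulate⁺ injective) (∈-deduplicate⁺ ℕ._≟_))

  unitItems : ∀ n → Vector Carrier n
  unitItems n _ = 1#

  validUnit : ∀ {n} → ValidSizes (unitItems n)
  validUnit _ = (0≤1 , 0≢1) , O.refl

  -- Two unit items in one bin would load it with at least `1# + 1#`, and `1# + 1# ≤ 1#` would give
  -- `1# ≤ 0#`.
  unitPacking-injective : ∀ {n} (p : Fin n → ℕ) → IsPacking (unitItems n) p →
                          ∀ {i j} → p i ≡ p j → i ≡ j
  unitPacking-injective p packing {i} {j} pᵢ≡pⱼ = decidable-stable (i Fin.≟ j) λ i≢j →
    1≰0 (cancel (O.trans (subst₂ (λ x y → x + y ≤ binLoad (unitItems _) p (p i)) (load refl) (load (sym pᵢ≡pⱼ))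
      (two-terms-≤-sum (λ k → if-nonNegative (does (p k ℕ.≟ p i)) 0≤1) i≢j)) (packing (p i))))
    where
    load : ∀ {k} → p k ≡ p i → (if does (p k ℕ.≟ p i) then 1# else 0#) ≡ 1#
    load {k} eq = cong (λ b → if b then 1# else 0#) (dec-true (p k ℕ.≟ p i) eq)
    cancel : 1# + 1# ≤ 1# → 1# ≤ 0#
    cancel 2≤1 = subst₂ _≤_ left (R.-‿inverseˡ 1#) (+-monoʳ-≤ (- 1#) 2≤1)
      where
      left : - 1# + (1# + 1#) ≡ 1#
      left = trans (sym (R.+-assoc (- 1#) 1# 1#)) (trans (cong (_+ 1#) (R.-‿inverseˡ 1#)) (R.+-identityˡ 1#))

  ¬¬-OPTˢ : ∀ {n} (σ : Vector Carrier n) p → IsPacking σ p → ¬ ¬ ∃ (IsOPTˢ σ)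
  ¬¬-OPTˢ σ p = ¬¬-minimum binsUsed {x = p}

  -- For c < 0 the bound is applied to unit items instead of σ: m + N of them need as many bins,
  -- where N is the number of bins used on σ.
  staticCost-≤ : ∀ A {c ℓ} → StaticCostBound A c ℓ →
                 ∀ {n} {σ : Vector Carrier n} → ValidSizes σ →
                 ∀ p → IsPacking σ p → ∀ {m} → binsUsed p ℕ.≤ m →
                 fromℕ (binsUsed (runˢ (pack A) σ)) ≤ c * fromℕ m + ℓ
  staticCost-≤ A {c} {ℓ} bound {σ = σ} valid p packing {m} used≤m with O.total 0# c
  ... | inj₁ 0≤c = decidable-stable (_ O.≤? _) λ fails →
    ¬¬-OPTˢ σ p packing λ (opt , isOPT) → fails (begin
      fromℕ (binsUsed (runˢ (pack A) σ))  ≤⟨ bound σ valid opt isOPT ⟩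
      c * fromℕ opt + ℓ                   ≤⟨ +-mono-≤ (*-monoˡ-≤ 0≤c (fromℕ-mono-≤
                                               (ℕ.≤-trans (proj₂ isOPT p packing) used≤m))) O.refl ⟩
      c * fromℕ m + ℓ                     ∎)
    where open ≤-Reasoning
  ... | inj₂ c≤0 = decidable-stable (_ O.≤? _) λ fails →
    ¬¬-OPTˢ units (runˢ (pack A) units) unitsPacked λ (opt , isOPT) → fails (begin
      fromℕ N                               ≤⟨ fromℕ-mono-≤ (ℕ.m≤n+m N m) ⟩
      fromℕ (m ℕ.+ N)                       ≤⟨ fromℕ-mono-≤ (manyBins (runˢ (pack A) units) unitsPacked) ⟩
      fromℕ (binsUsed (runˢ (pack A) units)) ≤⟨ bound units validUnit opt isOPT ⟩
      c * fromℕ opt + ℓ                     ≤⟨ +-mono-≤ (antitone (manyOPT opt isOPT)) O.refl ⟩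
      c * fromℕ (m ℕ.+ N) + ℓ               ≤⟨ +-mono-≤ (antitone (ℕ.m≤m+n m N)) O.refl ⟩
      c * fromℕ m + ℓ                       ∎)
    where
    open ≤-Reasoning
    N = binsUsed (runˢ (pack A) σ)
    units = unitItems (m ℕ.+ N)
    unitsPacked = feasible A units validUnit
    manyBins : ∀ q → IsPacking units q → m ℕ.+ N ℕ.≤ binsUsed q
    manyBins q packed = injective⇒binsUsed-≥ q (unitPacking-injective q packed)
    manyOPT : ∀ opt → IsOPTˢ units opt → m ℕ.+ N ℕ.≤ opt
    manyOPT opt ((q , packed , refl) , _) = manyBins q packed
    antitone : ∀ {i j} → i ℕ.≤ j → c * fromℕ j ≤ c * fromℕ i
    antitone {i} {j} i≤j = begin
      c * fromℕ j                          ≡⟨ cong (λ h → c * fromℕ h) (ℕ.m+[n∸m]≡n i≤j) ⟨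
      c * fromℕ (i ℕ.+ (j ∸ i))            ≡⟨ cong (c *_) (fromℕ-+ i (j ∸ i)) ⟩
      c * (fromℕ i + fromℕ (j ∸ i))        ≡⟨ R.distribˡ c _ _ ⟩
      c * fromℕ i + c * fromℕ (j ∸ i)      ≤⟨ +-monoʳ-≤ _ (nonPositive*nonNegative c≤0 (fromℕ-nonNegative (j ∸ i))) ⟩
      c * fromℕ i + 0#                     ≡⟨ R.+-identityʳ _ ⟩
      c * fromℕ i                          ∎

  -- Reuse of bins under bounded space.

  module _ {k A} (bounded : BoundedSpace k A) {n} (σ : Vector Carrier n) (valid : ValidSizes σ) where

    open BoundedSpace bounded

    private
      bin : Fin n → ℕ
      bin = runˢ (pack A) σ

      activeAfter : ℕ → List ℕ
      activeAfter m = active (take m (toList σ))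

      -- `BoundedSpace` speaks of complete instances. The first `m` items form one, and the
      -- algorithm treats them as it does inside `σ`, because a decision depends only on the earlier
      -- items and the current one.
      module Prefix {m} (m≤n : m ℕ.≤ n) where

        prefix : Vector Carrier m
        prefix i = σ (inject≤ i m≤n)

        validPrefix : ValidSizes prefix
        validPrefix i = valid (inject≤ i m≤n)

        toList-prefix : toList prefix ≡ take m (toList σ)
        toList-prefix = sym (take-tabulate m≤n σ)

        runˢ-prefix : ∀ i → runˢ (pack A) prefix i ≡ bin (inject≤ i m≤n)
        runˢ-prefix i = cong (λ h → pack A h (prefix i)) (begin
          take (toℕ i) (toList prefix)           ≡⟨ cong (take (toℕ i)) toList-prefix ⟩
          take (toℕ i) (take m (toList σ))       ≡⟨ take-take (toℕ i) m (toList σ) ⟩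
          take (toℕ i ℕ.⊓ m) (toList σ)          ≡⟨ cong (λ h → take h (toList σ)) (trans
                                                      (ℕ.m≤n⇒m⊓n≡m (ℕ.<⇒≤ (Fin.toℕ<n i)))
                                                      (sym (Fin.toℕ-inject≤ i m≤n))) ⟩
          take (toℕ (inject≤ i m≤n)) (toList σ)  ∎)
          where open ≡-Reasoning

    length-activeAfter : ∀ {m} → m ℕ.≤ n → length (activeAfter m) ℕ.≤ k
    length-activeAfter m≤n = subst (λ h → length (active h) ℕ.≤ k) toList-prefix (active-≤ prefix validPrefix)
      where open Prefix m≤n

    placed-before : ∀ i → bin i ∈ activeAfter (toℕ i) ⊎ (∀ {j} → j Fin.< i → bin j ≢ bin i)
    placed-before i with placed prefix validPrefix (σ i) (valid i)
      where open Prefix (ℕ.<⇒≤ (Fin.toℕ<n i))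
    ... | inj₁ bin∈ = inj₁ (subst (λ h → pack A h (σ i) ∈ active h) toList-prefix bin∈)
      where open Prefix (ℕ.<⇒≤ (Fin.toℕ<n i))
    ... | inj₂ new = inj₂ λ {j} j<i eq → new (fromℕ< j<i) (begin
      runˢ (pack A) prefix (fromℕ< j<i)    ≡⟨ runˢ-prefix (fromℕ< j<i) ⟩
      bin (inject≤ (fromℕ< j<i) i≤n)       ≡⟨ cong bin (Fin.toℕ-injective (trans (Fin.toℕ-inject≤ _ i≤n)
                                             (Fin.toℕ-fromℕ< j<i))) ⟩
      bin j                                ≡⟨ eq ⟩
      bin i                                ≡⟨ cong (λ h → pack A h (σ i)) toList-prefix ⟨
      pack A (toList prefix) (σ i)         ∎)
      where
      i≤n = ℕ.<⇒≤ (Fin.toℕ<n i)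
      open Prefix i≤n
      open ≡-Reasoning

    closed-before : ∀ i {b} → b ∈ activeAfter (suc (toℕ i)) → b ∈ activeAfter (toℕ i) ⊎ b ≡ bin i
    closed-before i {b} b∈ = subst (λ h → b ∈ active h ⊎ b ≡ pack A h (σ i)) toList-prefix
      (closed prefix validPrefix (σ i) (valid i) b (subst (λ h → b ∈ active h) (begin
        take (suc (toℕ i)) (toList σ)    ≡⟨ take-suc-tabulate σ i ⟩
        take (toℕ i) (toList σ) ∷ʳ σ i   ≡⟨ cong (_∷ʳ σ i) toList-prefix ⟨
        toList prefix ∷ʳ σ i             ∎) b∈))
      where
      open Prefix (ℕ.<⇒≤ (Fin.toℕ<n i))
      open ≡-Reasoning

    -- Since `i` has used the bin before `j`, it is not new for `j` and hence is active just before
    -- `j`. Going back from `j` to the cut `m` one item at a time, it stays active: an inactive bin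
    -- can become active only by receiving an item, and that would require it to be new, which `i`
    -- excludes.
    reused⇒active : ∀ {m i j} → toℕ i ℕ.< m → m ℕ.≤ toℕ j → bin i ≡ bin j → bin j ∈ activeAfter m
    reused⇒active {m} {i} {j} i<m m≤j reused with placed-before j
    ... | inj₂ new = contradiction reused (new (ℕ.<-≤-trans i<m m≤j))
    ... | inj₁ b∈  = still-active (toℕ j ∸ m) (subst (ℕ._≤ n) (sym m+d≡j) (ℕ.<⇒≤ (Fin.toℕ<n j)))
                       (subst (λ h → bin j ∈ activeAfter h) (sym m+d≡j) b∈)
      where
      m+d≡j = ℕ.m+[n∸m]≡n m≤j
      still-active : ∀ d → m ℕ.+ d ℕ.≤ n → bin j ∈ activeAfter (m ℕ.+ d) → bin j ∈ activeAfter m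
      still-active zero    _   b∈ = subst (λ h → bin j ∈ activeAfter h) (ℕ.+-identityʳ m) b∈
      still-active (suc d) m+d<n b∈ = still-active d (ℕ.<⇒≤ l<n) (subst (λ h → bin j ∈ activeAfter h) toℕ-l before-l)
        where
        l<n : m ℕ.+ d ℕ.< n
        l<n = subst (ℕ._≤ n) (ℕ.+-suc m d) m+d<n
        l = fromℕ< l<n
        toℕ-l : toℕ l ≡ m ℕ.+ d
        toℕ-l = Fin.toℕ-fromℕ< l<n
        i<l : i Fin.< l
        i<l = ℕ.<-≤-trans i<m (subst (m ℕ.≤_) (sym toℕ-l) (ℕ.m≤m+n m d))
        before-l : bin j ∈ activeAfter (toℕ l)
        before-l with closed-before l
          (subst (λ h → bin j ∈ activeAfter h) (trans (ℕ.+-suc m d) (cong suc (sym toℕ-l))) b∈)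
        ... | inj₁ b∈ = b∈
        -- Here item `l` itself goes into the bin, which is then either already active before `l` or
        -- new.
        ... | inj₂ b≡ with placed-before l
        ...   | inj₁ l∈  = subst (_∈ activeAfter (toℕ l)) (sym b≡) l∈
        ...   | inj₂ new = contradiction (trans reused b≡) (new i<l)

  -- Turning a schedule into a static packing.

  module _ (J : Instance) where

    private
      arrival : Fin (n J) → ℕ
      arrival = start ∘ intervals J

      sizes : Vector Carrier (n J)
      sizes = size ∘ intervals J

      activeItems : ℕ → List (Fin (n J))
      activeItems t = filter (λ i → activeAt? t (intervals J i)) (allFin (n J))

      timeSteps : List ℕ
      timeSteps = applyUpTo suc (T J)

    size-nonNegative : ∀ i → 0# ≤ sizes i
    size-nonNegative i = proj₁ (proj₁ (validSize J i))

    duration-≤-μ : ∀ i → duration (intervals J i) ℕ.≤ μ J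
    duration-≤-μ i = All.lookup (Extrema.xs≤max 0 _) (∈-tabulate⁺ {f = duration ∘ intervals J} i)

    end-≤ : ∀ i → end (intervals J i) ℕ.≤ arrival i ℕ.+ μ J
    end-≤ i = ℕ.≤-trans (ℕ.m≤n+m∸n _ (arrival i)) (ℕ.+-monoʳ-≤ (arrival i) (duration-≤-μ i))

    arrival-≤-T : ∀ i → arrival i ℕ.≤ T J
    arrival-≤-T i = ℕ.s≤s⁻¹ (ℕ.≤-trans (nonEmpty J i) (proj₂ (horizon J i)))

    -- All intervals lie between `1` and `suc (T J)`. Hence the truncated `T J ∸ μ J` is a true
    -- difference, on which the final count relies.
    μ-≤-T : μ J ℕ.≤ T J
    μ-≤-T = Extrema.max≤v⁺ z≤n (All.tabulate⁺ λ i → begin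
      end (intervals J i) ∸ arrival i  ≤⟨ ℕ.∸-mono (proj₂ (horizon J i)) (proj₁ (horizon J i)) ⟩
      suc (T J) ∸ 1                    ≡⟨⟩
      T J                              ∎)
      where open ℕ.≤-Reasoning

    totalCost-timeSteps : ∀ p → totalCost J p ≡ ℕ.sum (map (activeMachines J p) timeSteps)
    totalCost-timeSteps p = cong ℕ.sum (sym (map-applyUpTo suc (activeMachines J p) (T J)))

    ∈-activeItems : ∀ {t i} → ActiveAt t (intervals J i) → i ∈ activeItems t
    ∈-activeItems {i = i} = ∈-filter⁺ (λ i → activeAt? _ (intervals J i)) (∈-allFin i)

    activeAt-arrival : ∀ i → ActiveAt (arrival i) (intervals J i)
    activeAt-arrival i = ℕ.≤-refl , nonEmpty J i

    -- Codes a pair of a time and a machine as one bin label: times up to `T J` are recovered as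
    -- remainders modulo `suc (T J)`.
    startBin : ℕ → ℕ → ℕ
    startBin t m = t ℕ.+ m ℕ.* suc (T J)

    startBin-injective : ∀ {t t′ m m′} → t ℕ.≤ T J → t′ ℕ.≤ T J →
                         startBin t m ≡ startBin t′ m′ → t ≡ t′ × m ≡ m′
    startBin-injective {t} {t′} {m} {m′} t≤T t′≤T eq = t≡t′ ,
      ℕ.*-cancelʳ-≡ m m′ (suc (T J)) (ℕ.+-cancelˡ-≡ t _ _ (trans eq (cong (ℕ._+ m′ ℕ.* suc (T J)) (sym t≡t′))))
      where
      open ≡-Reasoning
      t≡t′ : t ≡ t′
      t≡t′ = begin
        t                            ≡⟨ m<n⇒m%n≡m (s≤s t≤T) ⟨
        t ℕ.% suc (T J)              ≡⟨ [m+kn]%n≡m%n t m (suc (T J)) ⟨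
        startBin t m ℕ.% suc (T J)   ≡⟨ cong (ℕ._% suc (T J)) eq ⟩
        startBin t′ m′ ℕ.% suc (T J) ≡⟨ [m+kn]%n≡m%n t′ m′ (suc (T J)) ⟩
        t′ ℕ.% suc (T J)             ≡⟨ m<n⇒m%n≡m (s≤s t′≤T) ⟩
        t′                           ∎

    module _ (q : Fin (n J) → ℕ) where

      startBins : Fin (n J) → ℕ
      startBins i = startBin (arrival i) (q i)

      -- Items in one bin share their arrival time and machine. All of them are active there at that
      -- time, so the machine's load bounds that of the bin.
      startBins-packing : IsSchedule J q → IsPacking sizes startBins
      startBins-packing schedule b with Fin.any? (λ i → startBins i ℕ.≟ b)
      ... | yes (i , refl) = O.trans (sum-mono-≤ λ j →
        if-mono-≤ (startBins j ℕ.≟ b)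
          (activeAt? (arrival i) (intervals J j) ×-dec (q j ℕ.≟ q i)) (size-nonNegative j) (together j))
        (schedule (arrival i) (q i))
        where
        together : ∀ j → startBins j ≡ startBins i → ActiveAt (arrival i) (intervals J j) × q j ≡ q i
        together j eq with startBin-injective (arrival-≤-T j) (arrival-≤-T i) eq
        ... | aⱼ≡aᵢ , qⱼ≡qᵢ = subst (λ t → ActiveAt t (intervals J j)) aⱼ≡aᵢ (activeAt-arrival j) , qⱼ≡qᵢ
      -- A bin without items is compared with the condition that never holds, whose sum is zero.
      ... | no unused = O.trans (sum-mono-≤ λ j →
        if-mono-≤ (startBins j ℕ.≟ b) (no id) (size-nonNegative j) λ eq → unused (j , eq))
        (subst (_≤ 1#) (sym (sum-replicate-zero (n J))) 0≤1)

      -- Each machine active at a time step contributes one label for that step, so the number of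
      -- labels listed is the total cost. The label of an item is listed at its arrival, when its
      -- machine is active.
      binsUsed-startBins : binsUsed startBins ℕ.≤ totalCost J q
      binsUsed-startBins = begin
        binsUsed startBins
          ≤⟨ binsUsed-≤ startBins covered ⟩
        length (concatMap bins timeSteps)
          ≡⟨ length-concatMap bins timeSteps ⟩
        ℕ.sum (map (length ∘ bins) timeSteps)
          ≡⟨ cong ℕ.sum (map-cong (λ t → length-map (startBin t) (machinesAt t)) timeSteps) ⟩
        ℕ.sum (map (activeMachines J q) timeSteps)
          ≡⟨ totalCost-timeSteps q ⟨
        totalCost J q ∎
        where
        open ℕ.≤-Reasoning
        machinesAt bins : ℕ → List ℕ
        machinesAt t = deduplicate ℕ._≟_ (map q (activeItems t))
        bins t = map (startBin t) (machinesAt t)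
        step∈ : ∀ i → arrival i ∈ timeSteps
        -- Time steps start at `1`, and `horizon` rules out an arrival at `0`.
        step∈ i with arrival i | proj₁ (horizon J i) | arrival-≤-T i
        ... | suc t | _ | t<T = ∈-applyUpTo⁺ suc t<T
        covered : ∀ i → startBins i ∈ concatMap bins timeSteps
        covered i = ∈-concat⁺′ (∈-map⁺ (startBin (arrival i))
          (∈-deduplicate⁺ ℕ._≟_ (∈-map⁺ q (∈-activeItems (activeAt-arrival i)))))
          (∈-map⁺ bins (step∈ i))

    -- The cost of an assignment that reuses few machines.

    module _ (p : Fin (n J) → ℕ) {k} (open-after : ℕ → List ℕ)
             (few-open : ∀ {m} → m ℕ.≤ n J → length (open-after m) ℕ.≤ k)
             -- This is the form in which bounded space enters: machines used on both sides of a cut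
             -- lie in a list of at most `k` entries.
             (reused⇒open : ∀ {m i j} → toℕ i ℕ.< m → m ℕ.≤ toℕ j → p i ≡ p j → p j ∈ open-after m)
             where

      private
        machines : List ℕ
        machines = deduplicate ℕ._≟_ (toList p)

        -- The minimum takes `T J` as a default. For a machine in use this does not change the
        -- value, since none of its items arrives after `T J`.
        openingTime : ℕ → ℕ
        openingTime m = Extrema.min (T J) (map arrival (filter (λ i → p i ℕ.≟ m) (allFin (n J))))

        openingTime-≤ : ∀ i → openingTime (p i) ℕ.≤ arrival i
        openingTime-≤ i = All.lookup (Extrema.min≤xs (T J) _)
          (∈-map⁺ arrival (∈-filter⁺ (λ j → p j ℕ.≟ p i) (∈-allFin i) refl))

        recentlyOpened? : ∀ t m → Dec (openingTime m ℕ.≤ t × t ℕ.< openingTime m ℕ.+ μ J)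
        recentlyOpened? t m = (openingTime m ℕ.≤? t) ×-dec (t ℕ.<? openingTime m ℕ.+ μ J)

        arrivedLongAgo? : ∀ t i → Dec (arrival i ℕ.+ μ J ℕ.≤ t)
        arrivedLongAgo? t i = arrival i ℕ.+ μ J ℕ.≤? t

        longAgo : ∀ t → ∃[ m ] m ℕ.≤ n J × (∀ {i} → arrival i ℕ.+ μ J ℕ.≤ t → toℕ i ℕ.< m) ×
                               (∀ {i} → toℕ i ℕ.< m → arrival i ℕ.+ μ J ℕ.≤ t)
        longAgo t = initial-segment (arrivedLongAgo? t)
          λ i≤j → ℕ.≤-trans (ℕ.+-monoˡ-≤ (μ J) (ordered J _ _ i≤j))

        -- Arrivals are at least `1`, so an arrival at least `μ J` steps before `t` forces
        -- `μ J < t`. Leaving the list empty up to `μ J` saves `k` at each of these steps, which is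
        -- what yields `max` of `k` and `ℓ` instead of their sum.
        oldMachines : ℕ → List ℕ
        oldMachines t = if does (μ J ℕ.<? t) then open-after (proj₁ (longAgo t)) else []

        length-oldMachines : ∀ t → length (oldMachines t) ℕ.≤ (if does (μ J ℕ.<? t) then k else 0)
        length-oldMachines t with does (μ J ℕ.<? t)
        ... | true  = few-open (proj₁ (proj₂ (longAgo t)))
        ... | false = z≤n

        1≤μ : 1 ℕ.≤ μ J
        1≤μ = let i , duration≡1 = shortest J in subst (ℕ._≤ μ J) duration≡1 (duration-≤-μ i)

        -- An item active at `t` satisfies `t < arrival i + μ J`. If the same machine holds an item
        -- `j` that arrived long ago, it is reused across the cut; otherwise the strict bound holds
        -- for all its items and thus for its opening time.
        recent-or-old : ∀ {t} → t ℕ.≤ T J → ∀ i → ActiveAt t (intervals J i) →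
                        p i ∈ filter (recentlyOpened? t) machines ++ oldMachines t
        recent-or-old {t} t≤T i (arrived , notEnded)
          with Fin.any? (λ j → (p j ℕ.≟ p i) ×-dec arrivedLongAgo? t j)
        ... | yes (j , same , long) = ∈-++⁺ʳ (filter (recentlyOpened? t) machines)
          (subst (λ b → p i ∈ (if b then open-after (proj₁ (longAgo t)) else []))
            (sym (dec-true (μ J ℕ.<? t) (ℕ.≤-trans (ℕ.+-monoˡ-≤ (μ J) (proj₁ (horizon J j))) long)))
            -- Item `j` lies before the cut, and `i` does not, since it is still active at `t`.
            (reused⇒open (before-cut long) (ℕ.≮⇒≥ λ i<m → ℕ.<⇒≱ t<arrival+μ (after-cut i<m)) same))
          where
          before-cut = proj₁ (proj₂ (proj₂ (longAgo t)))
          after-cut  = proj₂ (proj₂ (proj₂ (longAgo t)))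
          t<arrival+μ : t ℕ.< arrival i ℕ.+ μ J
          t<arrival+μ = ℕ.<-≤-trans notEnded (end-≤ i)
        ... | no none = ∈-++⁺ˡ (∈-filter⁺ (recentlyOpened? t)
          (∈-deduplicate⁺ ℕ._≟_ (∈-tabulate⁺ i))
          (ℕ.≤-trans (openingTime-≤ i) arrived , Extrema.argmin-all id {P = λ v → t ℕ.< v ℕ.+ μ J}
            -- The default `T J` of the minimum must satisfy the strict bound too, which takes
            -- `1 ≤ μ J`.
            (ℕ.≤-<-trans t≤T (ℕ.m<m+n (T J) 1≤μ))
            (All.map⁺ (All.map (λ {j} same → ℕ.≰⇒> λ long → none (j , same , long))
              (All.all-filter (λ j → p j ℕ.≟ p i) (allFin (n J)))))))

        activeMachines-≤ : ∀ {t} → t ∈ timeSteps →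
          activeMachines J p t ℕ.≤
          length (filter (recentlyOpened? t) machines) ℕ.+ (if does (μ J ℕ.<? t) then k else 0)
        activeMachines-≤ {t} t∈ = begin
          activeMachines J p t
            ≤⟨ distinct-≤ sub ⟩
          length (filter (recentlyOpened? t) machines ++ oldMachines t)
            ≡⟨ length-++ (filter (recentlyOpened? t) machines) ⟩
          length (filter (recentlyOpened? t) machines) ℕ.+ length (oldMachines t)
            ≤⟨ ℕ.+-monoʳ-≤ _ (length-oldMachines t) ⟩
          length (filter (recentlyOpened? t) machines) ℕ.+ (if does (μ J ℕ.<? t) then k else 0) ∎
          where
          open ℕ.≤-Reasoning
          t≤T : t ℕ.≤ T J
          t≤T with ∈-applyUpTo⁻ suc t∈
          ... | _ , t≤T , refl = t≤T
          sub : map p (activeItems t) ⊆ filter (recentlyOpened? t) machines ++ oldMachines t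
          sub m∈ with ∈-map⁻ p m∈
          ... | i , i∈ , refl = recent-or-old t≤T i
            (proj₂ (∈-filter⁻ (λ i → activeAt? t (intervals J i)) {xs = allFin (n J)} i∈))

      -- Summed machine by machine, a machine counts as recently opened at no more than `μ J` steps.
      -- The old machines add at most `k` at each step after `μ J`.
      totalCost-≤ : totalCost J p ℕ.≤ binsUsed p ℕ.* μ J ℕ.+ (T J ∸ μ J) ℕ.* k
      totalCost-≤ = begin
        totalCost J p
          ≡⟨ totalCost-timeSteps p ⟩
        ℕ.sum (map (activeMachines J p) timeSteps)
          ≤⟨ sum-map-mono timeSteps activeMachines-≤ ⟩
        ℕ.sum (map (λ t → length (filter (recentlyOpened? t) machines)
                            ℕ.+ (if does (μ J ℕ.<? t) then k else 0)) timeSteps)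
          ≡⟨ sum-map-+ _ _ timeSteps ⟩
        ℕ.sum (map (λ t → length (filter (recentlyOpened? t) machines)) timeSteps)
          ℕ.+ ℕ.sum (map (λ t → if does (μ J ℕ.<? t) then k else 0) timeSteps)
          ≡⟨ cong₂ ℕ._+_ (double-counting recentlyOpened? timeSteps machines)
                         (sum-map-if (μ J ℕ.<?_) k timeSteps) ⟩
        ℕ.sum (map (λ m → length (filter (λ t → recentlyOpened? t m) timeSteps)) machines)
          ℕ.+ length (filter (μ J ℕ.<?_) timeSteps) ℕ.* k
          ≤⟨ ℕ.+-mono-≤
               (sum-map-≤ machines λ m →
                 length-filter-steps (λ t → recentlyOpened? t m) (T J) (openingTime m) (μ J)
                   λ recent _ _ → recent)
               -- The window starts at `suc (μ J)` and, because `μ J ≤ T J`, ends just before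
               -- `suc (T J)`.
               (ℕ.*-monoˡ-≤ k (length-filter-steps (μ J ℕ.<?_) (T J) (suc (μ J)) (T J ∸ μ J)
                 λ μ<t _ t≤T → μ<t , s≤s (subst (_ ℕ.≤_) (sym (ℕ.m+[n∸m]≡n μ-≤-T)) t≤T))) ⟩
        binsUsed p ℕ.* μ J ℕ.+ (T J ∸ μ J) ℕ.* k ∎
        where open ℕ.≤-Reasoning

  -- The online algorithm and its average cost.

  ignoreDepartures : StaticAlgorithm → List Observation → ℕ → Carrier → ℕ
  ignoreDepartures A observed now w = pack A (map Observation.weight observed) w

  -- The weight in an observation does not depend on the time of observing, so the static algorithm
  -- is shown the same history in both runs.
  run-ignoreDepartures : ∀ A J i → run (ignoreDepartures A) J i ≡ runˢ (pack A) (size ∘ intervals J) i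
  run-ignoreDepartures A J i = cong (λ h → pack A h (size I)) (begin
    map Observation.weight (map (observe (start I)) (before (intervals J) i))  ≡⟨ map-∘ (before (intervals J) i) ⟨
    map size (take (toℕ i) (toList (intervals J)))                             ≡⟨ take-map (toℕ i) (toList (intervals J)) ⟨
    take (toℕ i) (map size (toList (intervals J)))                             ≡⟨ cong (take (toℕ i)) (map-tabulate (intervals J) size) ⟩
    before (size ∘ intervals J) i                                              ∎)
    where
    open ≡-Reasoning
    I = intervals J i

  -- What is active on a machine at any time is part of the content of the corresponding bin, which
  -- fits even without departures.
  ignoreDepartures-feasible : ∀ A J → IsSchedule J (run (ignoreDepartures A) J)
  ignoreDepartures-feasible A J t m = O.trans
    (sum-mono-≤ λ i → if-mono-≤
      (activeAt? t (intervals J i) ×-dec (run (ignoreDepartures A) J i ℕ.≟ m))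
      (runˢ (pack A) (size ∘ intervals J) i ℕ.≟ m)
      (size-nonNegative J i)
      λ (_ , eq) → trans (sym (run-ignoreDepartures A J i)) eq)
    (feasible A (size ∘ intervals J) (validSize J) m)

  packAll : StaticAlgorithm → NonClairvoyantAlgorithm
  packAll A = record { assign = ignoreDepartures A ; feasible = ignoreDepartures-feasible A }

  totalCost-packAll-≤ : ∀ {A k} → BoundedSpace k A → ∀ J →
    totalCost J (run (assign (packAll A)) J) ℕ.≤
    binsUsed (runˢ (pack A) (size ∘ intervals J)) ℕ.* μ J ℕ.+ (T J ∸ μ J) ℕ.* k
  totalCost-packAll-≤ {A} {k} bounded J = subst
    (λ h → totalCost J assigned ℕ.≤ h ℕ.* μ J ℕ.+ (T J ∸ μ J) ℕ.* k)
    -- The two assignments agree pointwise, which makes their lists of values equal and hence also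
    -- the numbers of bins.
    (cong distinct (tabulate-cong p≗bins))
    (totalCost-≤ J assigned (λ m → BoundedSpace.active bounded (take m (toList σ)))
      (length-activeAfter bounded σ (validSize J))
      λ {m} {i} {j} i<m m≤j pᵢ≡pⱼ → subst (_∈ BoundedSpace.active bounded (take m (toList σ))) (sym (p≗bins j))
        (reused⇒active bounded σ (validSize J) i<m m≤j (trans (sym (p≗bins i)) (trans pᵢ≡pⱼ (p≗bins j)))))
    where
    σ = size ∘ intervals J
    assigned = run (assign (packAll A)) J
    p≗bins = run-ignoreDepartures A J

  -- With `k` and `ℓ` both raised to their maximum `M`, the additive terms `μ J` times `M` and
  -- `T J ∸ μ J` times `M` combine to `T J` times `M`.
  totalCost-packAll-≤-OPT : ∀ {A k c ℓ} → BoundedSpace k A → StaticCostBound A c ℓ →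
    ∀ J {opt} → IsOPT J opt →
    fromℕ (totalCost J (run (assign (packAll A)) J)) ≤
    c * fromℕ (μ J) * fromℕ opt + max (fromℕ k) ℓ * fromℕ (T J)
  totalCost-packAll-≤-OPT {A} {k} {c} {ℓ} bounded bound J {opt} ((q , schedule , refl) , _) = begin
    fromℕ (totalCost J (run (assign (packAll A)) J))
      ≤⟨ fromℕ-mono-≤ (totalCost-packAll-≤ bounded J) ⟩
    fromℕ (N ℕ.* μ J ℕ.+ (T J ∸ μ J) ℕ.* k)
      ≡⟨ fromℕ-+ (N ℕ.* μ J) _ ⟩
    fromℕ (N ℕ.* μ J) + fromℕ ((T J ∸ μ J) ℕ.* k)
      ≡⟨ cong₂ _+_ (trans (fromℕ-* N (μ J)) (R.*-comm _ _)) (fromℕ-* (T J ∸ μ J) k) ⟩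
    fμ * fromℕ N + fT-μ * fromℕ k
      ≤⟨ +-mono-≤ (*-monoˡ-≤ (fromℕ-nonNegative (μ J)) fewBins)
                  (*-monoˡ-≤ (fromℕ-nonNegative (T J ∸ μ J)) (Max.x≤x⊔y (fromℕ k) ℓ)) ⟩
    fμ * (c * fopt + ℓ) + fT-μ * M
      ≤⟨ +-mono-≤ (*-monoˡ-≤ (fromℕ-nonNegative (μ J)) (+-monoʳ-≤ _ (Max.x≤y⊔x (fromℕ k) ℓ))) O.refl ⟩
    fμ * (c * fopt + M) + fT-μ * M
      ≡⟨ cong (_+ fT-μ * M) (R.distribˡ fμ _ M) ⟩
    fμ * (c * fopt) + fμ * M + fT-μ * M
      ≡⟨ R.+-assoc _ _ _ ⟩
    fμ * (c * fopt) + (fμ * M + fT-μ * M)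
      ≡⟨ cong₂ _+_ (trans (sym (R.*-assoc fμ c fopt)) (cong (_* fopt) (R.*-comm fμ c)))
                   (sym (R.distribʳ M fμ fT-μ)) ⟩
    c * fμ * fopt + (fμ + fT-μ) * M
      ≡⟨ cong (λ h → c * fμ * fopt + h) (R.*-comm _ M) ⟩
    c * fμ * fopt + M * (fμ + fT-μ)
      ≡⟨ cong (λ h → c * fμ * fopt + M * h) (trans
           (sym (fromℕ-+ (μ J) (T J ∸ μ J))) (cong fromℕ (ℕ.m+[n∸m]≡n (μ-≤-T J)))) ⟩
    c * fμ * fopt + M * fromℕ (T J) ∎
    where
    open ≤-Reasoning
    module Max = MaxProperties O.totalOrder
    N = binsUsed (runˢ (pack A) (size ∘ intervals J))
    M = max (fromℕ k) ℓ
    fμ = fromℕ (μ J)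
    fT-μ = fromℕ (T J ∸ μ J)
    fopt = fromℕ (totalCost J q)
    fewBins : fromℕ N ≤ c * fopt + ℓ
    fewBins = staticCost-≤ A bound (validSize J) (startBins J q)
      (startBins-packing J q schedule) (binsUsed-startBins J q)

  average-packAll-≤ : ∀ {A k c ℓ} → BoundedSpace k A → StaticCostBound A c ℓ →
    ∀ J opt → IsOPT J opt →
    average J (totalCost J (run (assign (packAll A)) J)) ≤
    c * fromℕ (μ J) * average J opt + max (fromℕ k) ℓ
  average-packAll-≤ {A} {k} {c} {ℓ} bounded bound J opt isOPT = begin
    fromℕ (totalCost J (run (assign (packAll A)) J)) * fT ⁻¹
      ≤⟨ *-monoʳ-≤ (⁻¹-nonNegative (fromℕ-nonNegative (T J)) fT≢0)
                   (totalCost-packAll-≤-OPT bounded bound J isOPT) ⟩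
    (c * fromℕ (μ J) * fromℕ opt + M * fT) * fT ⁻¹
      ≡⟨ R.distribʳ (fT ⁻¹) _ _ ⟩
    c * fromℕ (μ J) * fromℕ opt * fT ⁻¹ + M * fT * fT ⁻¹
      ≡⟨ cong₂ _+_ (R.*-assoc _ _ _) (R.*-assoc M fT _) ⟩
    c * fromℕ (μ J) * (fromℕ opt * fT ⁻¹) + M * (fT * fT ⁻¹)
      ≡⟨ cong (λ h → c * fromℕ (μ J) * (fromℕ opt * fT ⁻¹) + M * h) (⁻¹-inverseʳ fT fT≢0) ⟩
    c * fromℕ (μ J) * (fromℕ opt * fT ⁻¹) + M * 1#
      ≡⟨ cong (λ h → c * fromℕ (μ J) * (fromℕ opt * fT ⁻¹) + h) (R.*-identityʳ M) ⟩
    c * fromℕ (μ J) * average J opt + M ∎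
    where
    open ≤-Reasoning
    M = max (fromℕ k) ℓ
    fT = fromℕ (T J)
    -- The interval given by `shortest` arrives at some step between `1` and `T J`, so `T J` is
    -- positive.
    fT≢0 : fT ≢ 0#
    fT≢0 with T J | ℕ.≤-trans (proj₁ (horizon J i)) (arrival-≤-T J i)
      where i = proj₁ (shortest J)
    ... | suc T | _ = fromℕ-suc≢0 T

lemma1p4 : ∀ {a r : Level} (F : OrderedField a r) →
    let open OrderedField F
        open BinPacking F
    in
    (A : StaticAlgorithm) (k : ℕ) (c ℓ : Carrier) →
    BoundedSpace k A →
    StaticCostBound A c ℓ →
    ∃[ D ] (∀ (J : Instance) (opt : ℕ) → IsOPT J opt →
      average J (totalCost J (run (assign D) J))
        ≤ c * fromℕ (μ J) * average J opt + max (fromℕ k) ℓ)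
lemma1p4 F A k c ℓ bounded bound = packAll A , average-packAll-≤ bounded bound
  where open BinPackingProperties F
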